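{- For every integer $k$ and every integer $n\geq 0$, \[ b_{n}^{(k)}(x)=\sum_{l=0}^{n}\binom{n}{l}\left(\sum_{p=1}^{l+1}\frac{(-1)^{p+l+1}}{p^{k}}\,p!\,\frac{S_{2}(l+1,p)}{l+1}\right)b_{n-l}(x). \]
   Context: For $k\in\mathbb{Z}$, the polylogarithm is $Li_k(x)=\sum_{n=1}^{\infty}\frac{x^n}{n^k}$. The poly-Bernoulli polynomials of the second kind $b_n^{(k)}(x)$ are defined by the generating function \[ \frac{Li_{k}(1-e^{ -t})}{\log(1+t)}(1+t)^{x}=\sum_{n=0}^{\infty}b_{n}^{(k)}(x)\frac{t^{n}}{n!}. \] The Bernoulli polynomials of the second kind $b_n(x)$ are defined by $\frac{t}{\log(1+t)}(1+t)^x=\sum_{n=0}^{\infty}b_n(x)\frac{t^n}{n!}$. $S_2(n,l)$ denotes the Stirling numbers of the second kind, defined by $x^n=\sum_{l=0}^{n}S_2(n,l)(x)_l$, where $(x)_l=x(x-1)\cdots(x-l+1)$. -}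

module Defs where

open import Algebra.Bundles using (RawSemiring)
import Algebra.Definitions.RawMonoid as RawMonoidDefs
import Algebra.Definitions.RawSemiring as RawSemiringDefs
import Algebra.Properties.AbelianGroup as AbelianGroupProperties
open import Data.Fin.Base using (toℕ)
open import Data.Integer.Base as ℤ using (ℤ)
open import Data.List.Base using (List; []; _∷_; map)
open import Data.Nat.Base as ℕ using (ℕ; zero; suc; _∸_; _!)
open import Data.Nat.Properties using (m^n≢0; _!≢0)
open import Data.Rational.Base as ℚ
  using (ℚ; 0ℚ; 1ℚ; NonZero; _÷_; +-0-rawMonoid; +-*-rawSemiring)
  renaming (_+_ to _+ℚ_; _*_ to _*ℚ_; _-_ to _-ℚ_)
open import Data.Rational.Properties as ℚₚ using ()
open import Level using (0ℓ)
open import Relation.Binary.PropositionalEquality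

open RawSemiringDefs +-*-rawSemiring public using () renaming (_^_ to _^ℚ_)

fromℕ : ℕ → ℚ
fromℕ n = (ℤ.+ n) ℚ./ 1

1/_^_ : (n : ℕ) .{{_ : ℕ.NonZero n}} → ℤ → ℚ
1/ n ^ (ℤ.+ m)    = ℚ._/_ (ℤ.+ 1) (n ℕ.^ m) {{m^n≢0 n m}}
1/ n ^ ℤ.-[1+ m ] = fromℕ (n ℕ.^ suc m)

1/_! : ℕ → ℚ
1/ n ! = ℚ._/_ (ℤ.+ 1) (n !) {{n !≢0}}

[-1]^_ : ℕ → ℚ
[-1]^ n = (ℚ.- 1ℚ) ^ℚ n

-- ∑ℚ n f = f 0 + … + f (n - 1)
∑ℚ : (n : ℕ) → (ℕ → ℚ) → ℚ
∑ℚ n f = RawMonoidDefs.sum +-0-rawMonoid {n} (λ i → f (toℕ i))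

syntax ∑ℚ n (λ i → e) = ∑ℚ[ i < n ] e

-- Polynomials in x over ℚ: lists of coefficients, constant term first,
-- possibly with trailing zeros

ℚ[x] : Set
ℚ[x] = List ℚ

coeff : ℚ[x] → ℕ → ℚ
coeff []      _       = 0ℚ
coeff (a ∷ p) zero    = a
coeff (a ∷ p) (suc i) = coeff p i

infix 4 _≈_
_≈_ : ℚ[x] → ℚ[x] → Set
p ≈ q = ∀ i → coeff p i ≡ coeff q i

infixl 6 _+_
_+_ : ℚ[x] → ℚ[x] → ℚ[x]
[]      + q       = q
(a ∷ p) + []      = a ∷ p
(a ∷ p) + (b ∷ q) = (a +ℚ b) ∷ (p + q)

infixr 7 _•_
_•_ : ℚ → ℚ[x] → ℚ[x]
a • p = map (a *ℚ_) p

infixl 7 _*_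
_*_ : ℚ[x] → ℚ[x] → ℚ[x]
[]      * q = []
(a ∷ p) * q = a • q + (0ℚ ∷ p * q)

const : ℚ → ℚ[x]
const a = a ∷ []

x : ℚ[x]
x = 0ℚ ∷ 1ℚ ∷ []

ℚ[x]-rawSemiring : RawSemiring 0ℓ 0ℓ
ℚ[x]-rawSemiring = record
  { Carrier = ℚ[x] ; _≈_ = _≈_ ; _+_ = _+_ ; _*_ = _*_
  ; 0# = [] ; 1# = const 1ℚ }

open RawSemiringDefs ℚ[x]-rawSemiring public using (_^_)

-- ∑ n f = f 0 + … + f (n - 1)
∑ : (n : ℕ) → (ℕ → ℚ[x]) → ℚ[x]
∑ n f = RawSemiringDefs.sum ℚ[x]-rawSemiring {n} (λ i → f (toℕ i))

syntax ∑ n (λ i → e) = ∑[ i < n ] e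

-- The falling factorial (x)ₗ = x (x - 1) ⋯ (x - l + 1)
[x]_ : ℕ → ℚ[x]
[x] zero  = const 1ℚ
[x] suc l = [x] l * (x + const (ℚ.- fromℕ l))

-- Nothing is required of S n l for l > n.
IsStirling₂ : (ℕ → ℕ → ℚ) → Set
IsStirling₂ S = ∀ n → x ^ n ≈ ∑[ l < suc n ] (S n l • [x] l)

-- Formal power series in t, as sequences of coefficients

ℚ⟦t⟧ ℚ[x]⟦t⟧ : Set
ℚ⟦t⟧    = ℕ → ℚ
ℚ[x]⟦t⟧ = ℕ → ℚ[x]

infixl 6 _-ˢ_
_-ˢ_ : ℚ⟦t⟧ → ℚ⟦t⟧ → ℚ⟦t⟧
(f -ˢ g) n = f n -ℚ g n

infixl 7 _*ˢ_
_*ˢ_ : ℚ⟦t⟧ → ℚ⟦t⟧ → ℚ⟦t⟧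
(f *ˢ g) n = ∑ℚ[ i < suc n ] (f i *ℚ g (n ∸ i))

infixl 7 _•ˢ_
_•ˢ_ : ℚ⟦t⟧ → ℚ[x]⟦t⟧ → ℚ[x]⟦t⟧
(f •ˢ g) n = ∑[ i < suc n ] (f i • g (n ∸ i))

1ˢ : ℚ⟦t⟧
1ˢ zero    = 1ℚ
1ˢ (suc _) = 0ℚ

ℚ⟦t⟧-rawSemiring : RawSemiring 0ℓ 0ℓ
ℚ⟦t⟧-rawSemiring = record
  { Carrier = ℚ⟦t⟧ ; _≈_ = λ f g → ∀ n → f n ≡ g n
  ; _+_ = λ f g n → f n +ℚ g n ; _*_ = _*ˢ_ ; 0# = λ _ → 0ℚ ; 1# = 1ˢ }

open RawSemiringDefs ℚ⟦t⟧-rawSemiring public using () renaming (_^_ to _^ˢ_)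

-- Substitution f(g(t)), meaningful when g 0 ≡ 0: then the terms
-- f m · g(t) ^ m with m > n do not contribute to the coefficient of t ^ n.
infixr 9 _∘ˢ_
_∘ˢ_ : ℚ⟦t⟧ → ℚ⟦t⟧ → ℚ⟦t⟧
(f ∘ˢ g) n = ∑ℚ[ m < suc n ] (f m *ℚ (g ^ˢ m) n)

-- The quotient f / g of two series with zero constant term, where the
-- coefficient of t in g is invertible, computed by long division: its
-- constant term is c = f 1 / g 1, and the rest is t · ((f - c g) / t) / g.
-- It is characterised by /ˢ-correct below.
infixl 7 _/ˢ_
_/ˢ_ : (f g : ℚ⟦t⟧) .{{_ : NonZero (g 1)}} → ℚ⟦t⟧
(f /ˢ g) zero    = f 1 ÷ g 1
(f /ˢ g) (suc n) = ((λ m → f (suc m) -ℚ (f 1 ÷ g 1) *ℚ g (suc m)) /ˢ g) n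

p÷q*q≡p : ∀ p q .{{_ : NonZero q}} → (p ÷ q) *ℚ q ≡ p
p÷q*q≡p p q = begin
  p *ℚ ℚ.1/ q *ℚ q    ≡⟨ ℚₚ.*-assoc p (ℚ.1/ q) q ⟩
  p *ℚ (ℚ.1/ q *ℚ q)  ≡⟨ cong (p *ℚ_) (ℚₚ.*-inverseˡ q) ⟩
  p *ℚ 1ℚ           ≡⟨ ℚₚ.*-identityʳ p ⟩
  p                 ∎
  where open ≡-Reasoning

p+[q-p]≡q : ∀ p q → p +ℚ (q -ℚ p) ≡ q
p+[q-p]≡q p q = trans (sym (ℚₚ.+-assoc p q (ℚ.- p))) (xyx⁻¹≈y p q)
  where open AbelianGroupProperties ℚₚ.+-0-abelianGroup

/ˢ-correct : ∀ f g .{{_ : NonZero (g 1)}} → f 0 ≡ 0ℚ → g 0 ≡ 0ℚ →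
             ∀ n → ((f /ˢ g) *ˢ g) n ≡ f n
/ˢ-correct f g f₀ g₀ zero = begin
  (f 1 ÷ g 1) *ℚ g 0 +ℚ 0ℚ  ≡⟨ ℚₚ.+-identityʳ _ ⟩
  (f 1 ÷ g 1) *ℚ g 0        ≡⟨ cong ((f 1 ÷ g 1) *ℚ_) g₀ ⟩
  (f 1 ÷ g 1) *ℚ 0ℚ         ≡⟨ ℚₚ.*-zeroʳ (f 1 ÷ g 1) ⟩
  0ℚ                        ≡⟨ f₀ ⟨
  f 0                       ∎
  where open ≡-Reasoning
/ˢ-correct f g f₀ g₀ (suc n) = begin
  c *ℚ g (suc n) +ℚ ((h /ˢ g) *ˢ g) n                ≡⟨ cong (c *ℚ g (suc n) +ℚ_) (/ˢ-correct h g h₀ g₀ n) ⟩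
  c *ℚ g (suc n) +ℚ (f (suc n) -ℚ c *ℚ g (suc n))    ≡⟨ p+[q-p]≡q (c *ℚ g (suc n)) (f (suc n)) ⟩
  f (suc n)                                          ∎
  where
  open ≡-Reasoning
  c : ℚ
  c = f 1 ÷ g 1
  h : ℚ⟦t⟧
  h m = f (suc m) -ℚ c *ℚ g (suc m)
  h₀ : h 0 ≡ 0ℚ
  h₀ = trans (cong (f 1 -ℚ_) (p÷q*q≡p (f 1) (g 1))) (ℚₚ.+-inverseʳ (f 1))

t : ℚ⟦t⟧
t 1 = 1ℚ
t _ = 0ℚ

e^-t : ℚ⟦t⟧
e^-t n = [-1]^ n *ℚ 1/ n !

log[1+t] : ℚ⟦t⟧
log[1+t] zero    = 0ℚ
log[1+t] (suc n) = [-1]^ n *ℚ (ℤ.+ 1 ℚ./ suc n)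

-- The binomial series: the coefficient of t ^ n is (x)ₙ / n!.
[1+t]^x : ℚ[x]⟦t⟧
[1+t]^x n = 1/ n ! • [x] n

Li : ℤ → ℚ⟦t⟧
Li k zero    = 0ℚ
Li k (suc n) = 1/ suc n ^ k

-- The sequence a with generating function F = ∑ aₙ tⁿ / n!
fromEGF : ℚ[x]⟦t⟧ → ℕ → ℚ[x]
fromEGF F n = fromℕ (n !) • F n

bernoulli₂ : ℕ → ℚ[x]
bernoulli₂ = fromEGF ((t /ˢ log[1+t]) •ˢ [1+t]^x)

polyBernoulli₂ : ℤ → ℕ → ℚ[x]
polyBernoulli₂ k =
  fromEGF (((Li k ∘ˢ (1ˢ -ˢ e^-t)) /ˢ log[1+t]) •ˢ [1+t]^x)

{-# OPTIONS --safe #-}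

-- Write u = 1 - e⁻ᵗ and F = Li_k(u). Since F / log(1+t) = (F / t) (t / log(1+t)),
-- the sequence b⁽ᵏ⁾ is the binomial convolution of the Bernoulli polynomials of
-- the second kind with aₗ = l! [tˡ⁺¹] F. From u′ = 1 - u the powers of u satisfy
-- (uᵖ⁺¹)′ = (p + 1) (uᵖ - uᵖ⁺¹), which up to the factor (-1)ᵖ⁺ⁿ p! / n! is the
-- recurrence of the Stirling numbers: n! [tⁿ] uᵖ = (-1)ᵖ⁺ⁿ p! S₂(n,p). Summing
-- over p gives aₗ. The numbers S₂(n,l) with l ≤ n are determined by their
-- defining identity because each (x)ₗ is monic of degree l.

module Submission where

open import Defs
open import Algebra.Bundles using (CommutativeRing)
import Algebra.Properties.Group as GroupProperties
import Algebra.Properties.Semiring.Sum as SemiringSum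
open import Data.Fin.Base using (toℕ)
open import Data.Fin.Properties using (toℕ<n)
open import Data.Integer.Base as ℤ using (ℤ; +_)
import Data.Integer.Properties as ℤₚ
open import Data.List.Base using ([]; _∷_)
open import Data.Nat.Base as ℕ using (ℕ; zero; suc; _∸_; _!; _<_; s<s; s≤s⁻¹)
open import Data.Nat.Combinatorics using (_C_; nCk≡n!/k![n-k]!; [n∸k]!k!∣n!)
import Data.Nat.Coprimality as Coprimality
import Data.Nat.Divisibility as ℕDiv
open import Data.Nat.DivMod using (m/n*n≡m)
import Data.Nat.Properties as ℕₚ
open import Data.Rational.Base as ℚ using (ℚ; 0ℚ; 1ℚ; NonZero; _÷_; _/_; mkℚ)
  renaming (_+_ to _+ℚ_; _*_ to _*ℚ_; _-_ to _-ℚ_; -_ to -ℚ_)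
import Data.Rational.Properties as ℚₚ
open import Data.Rational.Solver using (module +-*-Solver)
open import Data.Sum.Base using (inj₁; inj₂)
open import Function.Base using (_∘_)
open import Relation.Binary.PropositionalEquality

open ≡-Reasoning
open +-*-Solver using (solve; con; _:+_; _:*_; _:-_; :-_; _:=_)
module Σℚ = SemiringSum (CommutativeRing.semiring ℚₚ.+-*-commutativeRing)

-- Naturals inside the rationals

-- For a variable `n` the gcd normalisation in `fromℕ n` is stuck. Exposing the constructor lets
-- rational addition and multiplication compute.
fromℕ≡mkℚ : ∀ n → fromℕ n ≡ mkℚ (+ n) 0 (Coprimality.sym (Coprimality.1-coprimeTo n))
fromℕ≡mkℚ n = ℚₚ.normalize-coprime (Coprimality.sym (Coprimality.1-coprimeTo n))

fromℕ-homo-+ : ∀ m n → fromℕ (m ℕ.+ n) ≡ fromℕ m +ℚ fromℕ n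
fromℕ-homo-+ m n rewrite fromℕ≡mkℚ m | fromℕ≡mkℚ n =
  cong (_/ 1) (sym (cong₂ ℤ._+_ (ℤₚ.*-identityʳ (+ m)) (ℤₚ.*-identityʳ (+ n))))

fromℕ-homo-* : ∀ m n → fromℕ (m ℕ.* n) ≡ fromℕ m *ℚ fromℕ n
fromℕ-homo-* m n rewrite fromℕ≡mkℚ m | fromℕ≡mkℚ n = cong (_/ 1) (ℤₚ.pos-* m n)

fromℕ-inverseʳ : ∀ n .{{_ : ℕ.NonZero n}} → fromℕ n *ℚ (+ 1 / n) ≡ 1ℚ
fromℕ-inverseʳ (suc n)
  rewrite fromℕ≡mkℚ (suc n) | ℚₚ.normalize-coprime (Coprimality.1-coprimeTo (suc n)) =
  ℚₚ.*-inverseʳ (mkℚ (+ suc n) 0 (Coprimality.sym (Coprimality.1-coprimeTo (suc n))))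

n!-inverse : ∀ n → fromℕ (n !) *ℚ 1/ n ! ≡ 1ℚ
n!-inverse n = fromℕ-inverseʳ (n !) {{n ℕₚ.!≢0}}

-- Finite sums

∑-cong : ∀ n {f g : ℕ → ℚ} → (∀ i → i < n → f i ≡ g i) → ∑ℚ n f ≡ ∑ℚ n g
∑-cong n f≗g = Σℚ.sum-cong-≗ (λ i → f≗g (toℕ i) (toℕ<n i))

∑-cong′ : ∀ n {f g : ℕ → ℚ} → (∀ i → f i ≡ g i) → ∑ℚ n f ≡ ∑ℚ n g
∑-cong′ n f≗g = ∑-cong n (λ i _ → f≗g i)

∑-distrib-+ : ∀ n (f g : ℕ → ℚ) → ∑ℚ[ i < n ] (f i +ℚ g i) ≡ ∑ℚ n f +ℚ ∑ℚ n g
∑-distrib-+ n f g = Σℚ.∑-distrib-+ {n} (f ∘ toℕ) (g ∘ toℕ)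

*-distribˡ-∑ : ∀ n a (f : ℕ → ℚ) → a *ℚ ∑ℚ n f ≡ ∑ℚ[ i < n ] (a *ℚ f i)
*-distribˡ-∑ n a f = Σℚ.*-distribˡ-sum {n} a (f ∘ toℕ)

∑-zero : ∀ n → ∑ℚ[ i < n ] 0ℚ ≡ 0ℚ
∑-zero = Σℚ.sum-replicate-zero

∑-init-last : ∀ n (f : ℕ → ℚ) → ∑ℚ (suc n) f ≡ ∑ℚ n f +ℚ f n
∑-init-last zero    f = ℚₚ.+-comm (f 0) 0ℚ
∑-init-last (suc n) f = begin
  f 0 +ℚ ∑ℚ (suc n) (f ∘ suc)           ≡⟨ cong (f 0 +ℚ_) (∑-init-last n (f ∘ suc)) ⟩
  f 0 +ℚ (∑ℚ n (f ∘ suc) +ℚ f (suc n))  ≡⟨ ℚₚ.+-assoc (f 0) _ _ ⟨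
  ∑ℚ (suc n) f +ℚ f (suc n)             ∎

-- The Cauchy product and quotients of power series

*ˢ-cong : ∀ {f f′ g g′ : ℚ⟦t⟧} → (∀ n → f n ≡ f′ n) → (∀ n → g n ≡ g′ n) →
          ∀ n → (f *ˢ g) n ≡ (f′ *ˢ g′) n
*ˢ-cong f≗f′ g≗g′ n = ∑-cong′ (suc n) (λ i → cong₂ _*ℚ_ (f≗f′ i) (g≗g′ (n ∸ i)))

*ˢ-scaleˡ : ∀ a (f g : ℚ⟦t⟧) n → ((λ m → a *ℚ f m) *ˢ g) n ≡ a *ℚ (f *ˢ g) n
*ˢ-scaleˡ a f g n = trans
  (∑-cong′ (suc n) (λ i → ℚₚ.*-assoc a (f i) (g (n ∸ i))))
  (sym (*-distribˡ-∑ (suc n) a (λ i → f i *ℚ g (n ∸ i))))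

*ˢ-scaleʳ : ∀ a (f g : ℚ⟦t⟧) n → (f *ˢ (λ m → a *ℚ g m)) n ≡ a *ℚ (f *ˢ g) n
*ˢ-scaleʳ a f g n = trans
  (∑-cong′ (suc n) (λ i → solve 3 (λ a f g → f :* (a :* g) := a :* (f :* g)) refl a (f i) (g (n ∸ i))))
  (sym (*-distribˡ-∑ (suc n) a (λ i → f i *ℚ g (n ∸ i))))

*ˢ-distribʳ-+ : ∀ (f g h : ℚ⟦t⟧) n → ((λ m → f m +ℚ g m) *ˢ h) n ≡ (f *ˢ h) n +ℚ (g *ˢ h) n
*ˢ-distribʳ-+ f g h n = trans
  (∑-cong′ (suc n) (λ i → ℚₚ.*-distribʳ-+ (h (n ∸ i)) (f i) (g i)))
  (∑-distrib-+ (suc n) (λ i → f i *ℚ h (n ∸ i)) (λ i → g i *ℚ h (n ∸ i)))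

*ˢ-distribʳ-- : ∀ (f g h : ℚ⟦t⟧) n → ((f -ˢ g) *ˢ h) n ≡ (f *ˢ h) n -ℚ (g *ˢ h) n
*ˢ-distribʳ-- f g h n = begin
  ((f -ˢ g) *ˢ h) n
    ≡⟨ *ˢ-cong {g = h} (λ m → solve 2 (λ f g → f :- g := f :+ con (-ℚ 1ℚ) :* g) refl
           (f m) (g m)) (λ _ → refl) n ⟩
  ((λ m → f m +ℚ -ℚ 1ℚ *ℚ g m) *ˢ h) n
    ≡⟨ *ˢ-distribʳ-+ f (λ m → -ℚ 1ℚ *ℚ g m) h n ⟩
  (f *ˢ h) n +ℚ ((λ m → -ℚ 1ℚ *ℚ g m) *ˢ h) n
    ≡⟨ cong ((f *ˢ h) n +ℚ_) (*ˢ-scaleˡ (-ℚ 1ℚ) g h n) ⟩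
  (f *ˢ h) n +ℚ -ℚ 1ℚ *ℚ (g *ˢ h) n
    ≡⟨ solve 2 (λ f g → f :+ con (-ℚ 1ℚ) :* g := f :- g) refl ((f *ˢ h) n) ((g *ˢ h) n) ⟩
  (f *ˢ h) n -ℚ (g *ˢ h) n ∎

*ˢ-distribˡ-- : ∀ (f g h : ℚ⟦t⟧) n → (f *ˢ (g -ˢ h)) n ≡ (f *ˢ g) n -ℚ (f *ˢ h) n
*ˢ-distribˡ-- f g h n = begin
  ∑ℚ[ i < suc n ] (f i *ℚ (g (n ∸ i) -ℚ h (n ∸ i)))
    ≡⟨ ∑-cong′ (suc n) (λ i → solve 3 (λ f g h → f :* (g :- h) := f :* g :+ con (-ℚ 1ℚ) :* (f :* h)) refl
           (f i) (g (n ∸ i)) (h (n ∸ i))) ⟩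
  ∑ℚ[ i < suc n ] (f i *ℚ g (n ∸ i) +ℚ -ℚ 1ℚ *ℚ (f i *ℚ h (n ∸ i)))
    ≡⟨ ∑-distrib-+ (suc n) (λ i → f i *ℚ g (n ∸ i)) (λ i → -ℚ 1ℚ *ℚ (f i *ℚ h (n ∸ i))) ⟩
  (f *ˢ g) n +ℚ ∑ℚ[ i < suc n ] (-ℚ 1ℚ *ℚ (f i *ℚ h (n ∸ i)))
    ≡⟨ cong ((f *ˢ g) n +ℚ_) (*-distribˡ-∑ (suc n) (-ℚ 1ℚ) (λ i → f i *ℚ h (n ∸ i))) ⟨
  (f *ˢ g) n +ℚ -ℚ 1ℚ *ℚ (f *ˢ h) n
    ≡⟨ solve 2 (λ f g → f :+ con (-ℚ 1ℚ) :* g := f :- g) refl ((f *ˢ g) n) ((f *ˢ h) n) ⟩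
  (f *ˢ g) n -ℚ (f *ˢ h) n ∎

*ˢ-identityˡ : ∀ (f : ℚ⟦t⟧) n → (1ˢ *ˢ f) n ≡ f n
*ˢ-identityˡ f n = begin
  1ℚ *ℚ f n +ℚ ∑ℚ[ i < n ] (0ℚ *ℚ f (n ∸ suc i))
    ≡⟨ cong₂ _+ℚ_ (ℚₚ.*-identityˡ (f n)) (∑-cong′ n (λ i → ℚₚ.*-zeroˡ (f (n ∸ suc i)))) ⟩
  f n +ℚ ∑ℚ[ i < n ] 0ℚ
    ≡⟨ cong (f n +ℚ_) (∑-zero n) ⟩
  f n +ℚ 0ℚ
    ≡⟨ ℚₚ.+-identityʳ (f n) ⟩
  f n ∎

-- The product at `suc n` unfolds definitionally to `f 0 *ℚ g (suc n) +ℚ ((f ∘ suc) *ˢ g) n`.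
-- Induction on the degree, with `f` varying, therefore needs only scaling and distributivity and no
-- exchange of a double sum.
*ˢ-assoc : ∀ (f g h : ℚ⟦t⟧) n → ((f *ˢ g) *ˢ h) n ≡ (f *ˢ (g *ˢ h)) n
*ˢ-assoc f g h zero = solve 3 (λ f g h → (f :* g :+ con 0ℚ) :* h :+ con 0ℚ := f :* (g :* h :+ con 0ℚ) :+ con 0ℚ) refl
       (f 0) (g 0) (h 0)
*ˢ-assoc f g h (suc n) = begin
  (f 0 *ℚ g 0 +ℚ 0ℚ) *ℚ h (suc n) +ℚ ((λ m → f 0 *ℚ g (suc m) +ℚ ((f ∘ suc) *ˢ g) m) *ˢ h) n
    ≡⟨ cong ((f 0 *ℚ g 0 +ℚ 0ℚ) *ℚ h (suc n) +ℚ_)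
         (*ˢ-distribʳ-+ (λ m → f 0 *ℚ g (suc m)) ((f ∘ suc) *ˢ g) h n) ⟩
  (f 0 *ℚ g 0 +ℚ 0ℚ) *ℚ h (suc n) +ℚ (((λ m → f 0 *ℚ g (suc m)) *ˢ h) n +ℚ (((f ∘ suc) *ˢ g) *ˢ h) n)
    ≡⟨ cong ((f 0 *ℚ g 0 +ℚ 0ℚ) *ℚ h (suc n) +ℚ_)
         (cong₂ _+ℚ_ (*ˢ-scaleˡ (f 0) (g ∘ suc) h n) (*ˢ-assoc (f ∘ suc) g h n)) ⟩
  (f 0 *ℚ g 0 +ℚ 0ℚ) *ℚ h (suc n) +ℚ (f 0 *ℚ ((g ∘ suc) *ˢ h) n +ℚ ((f ∘ suc) *ˢ (g *ˢ h)) n)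
    ≡⟨ solve 5 (λ f g h a b → (f :* g :+ con 0ℚ) :* h :+ (f :* a :+ b) := f :* (g :* h :+ a) :+ b) refl
         (f 0) (g 0) (h (suc n)) (((g ∘ suc) *ˢ h) n) (((f ∘ suc) *ˢ (g *ˢ h)) n) ⟩
  f 0 *ℚ (g *ˢ h) (suc n) +ℚ ((f ∘ suc) *ˢ (g *ˢ h)) n ∎

*ˢ-shiftˡ : ∀ (f g : ℚ⟦t⟧) → f 0 ≡ 0ℚ → ∀ n → (f *ˢ g) (suc n) ≡ ((f ∘ suc) *ˢ g) n
*ˢ-shiftˡ f g f₀ n = begin
  f 0 *ℚ g (suc n) +ℚ ((f ∘ suc) *ˢ g) n  ≡⟨ cong (λ a → a *ℚ g (suc n) +ℚ ((f ∘ suc) *ˢ g) n) f₀ ⟩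
  0ℚ *ℚ g (suc n) +ℚ ((f ∘ suc) *ˢ g) n   ≡⟨ solve 2 (λ a b → con 0ℚ :* a :+ b := b) refl
         (g (suc n)) (((f ∘ suc) *ˢ g) n) ⟩
  ((f ∘ suc) *ˢ g) n                      ∎

-- A factor t comes out of the right operand. The product unfolds along its left operand, so the
-- summand with `g 0` comes last and is reached by induction.
*ˢ-shiftʳ : ∀ (f g : ℚ⟦t⟧) → g 0 ≡ 0ℚ → ∀ n → (f *ˢ g) (suc n) ≡ (f *ˢ (g ∘ suc)) n
*ˢ-shiftʳ f g g₀ zero = begin
  f 0 *ℚ g 1 +ℚ (f 1 *ℚ g 0 +ℚ 0ℚ)  ≡⟨ cong (λ a → f 0 *ℚ g 1 +ℚ (f 1 *ℚ a +ℚ 0ℚ)) g₀ ⟩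
  f 0 *ℚ g 1 +ℚ (f 1 *ℚ 0ℚ +ℚ 0ℚ)   ≡⟨ solve 2 (λ a b → a :+ (b :* con 0ℚ :+ con 0ℚ) := a :+ con 0ℚ) refl
         (f 0 *ℚ g 1) (f 1) ⟩
  f 0 *ℚ g 1 +ℚ 0ℚ                  ∎
*ˢ-shiftʳ f g g₀ (suc n) = cong (f 0 *ℚ g (suc (suc n)) +ℚ_) (*ˢ-shiftʳ (f ∘ suc) g g₀ n)

-- f / g = (f / t) (t / g): unfolding one step of the long division on both
-- sides leaves a quotient by g, to which the induction hypothesis applies.
/ˢ-shift : ∀ f g .{{_ : NonZero (g 1)}} n → (f /ˢ g) n ≡ ((f ∘ suc) *ˢ (t /ˢ g)) n
/ˢ-shift f g zero =
  solve 2 (λ f c → f :* c := f :* (con 1ℚ :* c) :+ con 0ℚ) refl (f 1) (ℚ.1/ g 1)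
/ˢ-shift f g (suc n) = begin
  (r /ˢ g) n
    ≡⟨ /ˢ-shift r g n ⟩
  ((r ∘ suc) *ˢ q) n
    ≡⟨ *ˢ-distribʳ-- (f ∘ suc ∘ suc) (λ m → (f 1 ÷ g 1) *ℚ g (suc (suc m))) q n ⟩
  F -ℚ ((λ m → (f 1 ÷ g 1) *ℚ g (suc (suc m))) *ˢ q) n
    ≡⟨ cong (λ a → F -ℚ a) (*ˢ-scaleˡ (f 1 ÷ g 1) (g ∘ suc ∘ suc) q n) ⟩
  F -ℚ (f 1 ÷ g 1) *ℚ G
    ≡⟨ solve 4 (λ F f c G → F :- (f :* c) :* G := f :* (con 0ℚ :- (con 1ℚ :* c) :* G) :+ F) refl
         F (f 1) (ℚ.1/ g 1) G ⟩
  f 1 *ℚ (0ℚ -ℚ (1ℚ ÷ g 1) *ℚ G) +ℚ F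
    ≡⟨ cong (λ a → f 1 *ℚ a +ℚ F) q-suc ⟨
  f 1 *ℚ q (suc n) +ℚ F ∎
  where
  q r rₜ : ℚ⟦t⟧
  q = t /ˢ g
  r m = f (suc m) -ℚ (f 1 ÷ g 1) *ℚ g (suc m)
  rₜ m = t (suc m) -ℚ (1ℚ ÷ g 1) *ℚ g (suc m)
  F G : ℚ
  F = ((f ∘ suc ∘ suc) *ˢ q) n
  G = ((g ∘ suc ∘ suc) *ˢ q) n
  q-suc : q (suc n) ≡ 0ℚ -ℚ (1ℚ ÷ g 1) *ℚ G
  q-suc = begin
    (rₜ /ˢ g) n
      ≡⟨ /ˢ-shift rₜ g n ⟩
    ((rₜ ∘ suc) *ˢ q) n
      ≡⟨ *ˢ-distribʳ-- (λ _ → 0ℚ) (λ m → (1ℚ ÷ g 1) *ℚ g (suc (suc m))) q n ⟩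
    ((λ _ → 0ℚ) *ˢ q) n -ℚ ((λ m → (1ℚ ÷ g 1) *ℚ g (suc (suc m))) *ˢ q) n
      ≡⟨ cong₂ _-ℚ_
           (trans (∑-cong′ (suc n) (λ i → ℚₚ.*-zeroˡ (q (n ∸ i)))) (∑-zero (suc n)))
           (*ˢ-scaleˡ (1ℚ ÷ g 1) (g ∘ suc ∘ suc) q n) ⟩
    0ℚ -ℚ (1ℚ ÷ g 1) *ℚ G ∎

-- The Euler operator

-- θ = t d/dt
θ : ℚ⟦t⟧ → ℚ⟦t⟧
θ f n = fromℕ n *ℚ f n

θ-zero : ∀ f → θ f 0 ≡ 0ℚ
θ-zero f = ℚₚ.*-zeroˡ (f 0)

-- The weight n of each summand splits as i + (n - i), using i ≤ n. With t d/dt in place of d/dt the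
-- rule involves no index shift.
θ-leibniz : ∀ f g n → θ (f *ˢ g) n ≡ (θ f *ˢ g) n +ℚ (f *ˢ θ g) n
θ-leibniz f g n = begin
  fromℕ n *ℚ (f *ˢ g) n
    ≡⟨ *-distribˡ-∑ (suc n) (fromℕ n) (λ i → f i *ℚ g (n ∸ i)) ⟩
  ∑ℚ[ i < suc n ] (fromℕ n *ℚ (f i *ℚ g (n ∸ i)))
    ≡⟨ ∑-cong (suc n) (λ i i<1+n → begin
         fromℕ n *ℚ (f i *ℚ g (n ∸ i))
           ≡⟨ cong (λ m → fromℕ m *ℚ (f i *ℚ g (n ∸ i))) (ℕₚ.m+[n∸m]≡n (s≤s⁻¹ i<1+n)) ⟨
         fromℕ (i ℕ.+ (n ∸ i)) *ℚ (f i *ℚ g (n ∸ i))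
           ≡⟨ cong (_*ℚ (f i *ℚ g (n ∸ i))) (fromℕ-homo-+ i (n ∸ i)) ⟩
         (fromℕ i +ℚ fromℕ (n ∸ i)) *ℚ (f i *ℚ g (n ∸ i))
           ≡⟨ solve 4 (λ a b f g → (a :+ b) :* (f :* g) := a :* f :* g :+ f :* (b :* g)) refl
                (fromℕ i) (fromℕ (n ∸ i)) (f i) (g (n ∸ i)) ⟩
         θ f i *ℚ g (n ∸ i) +ℚ f i *ℚ θ g (n ∸ i) ∎) ⟩
  ∑ℚ[ i < suc n ] (θ f i *ℚ g (n ∸ i) +ℚ f i *ℚ θ g (n ∸ i))
    ≡⟨ ∑-distrib-+ (suc n) (λ i → θ f i *ℚ g (n ∸ i)) (λ i → f i *ℚ θ g (n ∸ i)) ⟩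
  (θ f *ˢ g) n +ℚ (f *ˢ θ g) n ∎

-- Powers of 1 - e⁻ᵗ

1-e^-t : ℚ⟦t⟧
1-e^-t = 1ˢ -ˢ e^-t

1/n!-suc : ∀ n → fromℕ (suc n) *ℚ 1/ suc n ! ≡ 1/ n !
1/n!-suc n = begin
  fromℕ (suc n) *ℚ 1/ suc n !
    ≡⟨ ℚₚ.*-identityʳ _ ⟨
  fromℕ (suc n) *ℚ 1/ suc n ! *ℚ 1ℚ
    ≡⟨ cong (fromℕ (suc n) *ℚ 1/ suc n ! *ℚ_) (n!-inverse n) ⟨
  fromℕ (suc n) *ℚ 1/ suc n ! *ℚ (fromℕ (n !) *ℚ 1/ n !)
    ≡⟨ solve 4 (λ a b c d → a :* b :* (c :* d) := (a :* c) :* b :* d) refl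
         (fromℕ (suc n)) (1/ suc n !) (fromℕ (n !)) (1/ n !) ⟩
  fromℕ (suc n) *ℚ fromℕ (n !) *ℚ 1/ suc n ! *ℚ 1/ n !
    ≡⟨ cong (λ a → a *ℚ 1/ suc n ! *ℚ 1/ n !) (fromℕ-homo-* (suc n) (n !)) ⟨
  fromℕ (suc n !) *ℚ 1/ suc n ! *ℚ 1/ n !
    ≡⟨ cong (_*ℚ 1/ n !) (n!-inverse (suc n)) ⟩
  1ℚ *ℚ 1/ n !
    ≡⟨ ℚₚ.*-identityˡ _ ⟩
  1/ n ! ∎

-- The equation u′ = 1 - u for u = 1 - e⁻ᵗ: the coefficient of tⁿ⁺¹ in t u′ is that of tⁿ in u′, and
-- both sides equal `e^-t n`.
θ-1-e^-t : ∀ n → θ 1-e^-t (suc n) ≡ (1ˢ -ˢ 1-e^-t) n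
θ-1-e^-t n = begin
  fromℕ (suc n) *ℚ (0ℚ -ℚ (-ℚ 1ℚ *ℚ [-1]^ n) *ℚ 1/ suc n !)
    ≡⟨ solve 3 (λ m s c → m :* (con 0ℚ :- (con (-ℚ 1ℚ) :* s) :* c) := s :* (m :* c)) refl
         (fromℕ (suc n)) ([-1]^ n) (1/ suc n !) ⟩
  [-1]^ n *ℚ (fromℕ (suc n) *ℚ 1/ suc n !)
    ≡⟨ cong ([-1]^ n *ℚ_) (1/n!-suc n) ⟩
  e^-t n
    ≡⟨ solve 2 (λ a b → a := b :- (b :- a)) refl (e^-t n) (1ˢ n) ⟩
  (1ˢ -ˢ 1-e^-t) n ∎

-- Induction on p through the Leibniz rule for u · uᵖ: u′ uᵖ is (1 - u) uᵖ = uᵖ - uᵖ⁺¹, and u (uᵖ)′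
-- is p times the same difference.
θ-[1-e^-t]^ : ∀ p n → θ (1-e^-t ^ˢ suc p) (suc n) ≡
              fromℕ (suc p) *ℚ ((1-e^-t ^ˢ p) n -ℚ (1-e^-t ^ˢ suc p) n)
θ-[1-e^-t]^ p n = begin
  θ (u *ˢ (u ^ˢ p)) (suc n)
    ≡⟨ θ-leibniz u (u ^ˢ p) (suc n) ⟩
  (θ u *ˢ (u ^ˢ p)) (suc n) +ℚ (u *ˢ θ (u ^ˢ p)) (suc n)
    -- Images under `θ` have no constant term, so a factor t comes out of each product and t d/dt
    -- becomes d/dt.
    ≡⟨ cong₂ _+ℚ_ (*ˢ-shiftˡ (θ u) (u ^ˢ p) (θ-zero u) n) (*ˢ-shiftʳ u (θ (u ^ˢ p)) (θ-zero (u ^ˢ p)) n) ⟩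
  ((θ u ∘ suc) *ˢ (u ^ˢ p)) n +ℚ (u *ˢ (θ (u ^ˢ p) ∘ suc)) n
    ≡⟨ cong₂ _+ℚ_ first (second p) ⟩
  d +ℚ fromℕ p *ℚ d
    ≡⟨ solve 2 (λ d p → d :+ p :* d := (con 1ℚ :+ p) :* d) refl d (fromℕ p) ⟩
  (1ℚ +ℚ fromℕ p) *ℚ d
    ≡⟨ cong (_*ℚ d) (fromℕ-homo-+ 1 p) ⟨
  fromℕ (suc p) *ℚ d ∎
  where
  u : ℚ⟦t⟧
  u = 1-e^-t
  d : ℚ
  d = (u ^ˢ p) n -ℚ (u ^ˢ suc p) n
  first : ((θ u ∘ suc) *ˢ (u ^ˢ p)) n ≡ d
  first = begin
    ((θ u ∘ suc) *ˢ (u ^ˢ p)) n                ≡⟨ *ˢ-cong {g = u ^ˢ p} θ-1-e^-t (λ _ → refl) n ⟩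
    ((1ˢ -ˢ u) *ˢ (u ^ˢ p)) n                  ≡⟨ *ˢ-distribʳ-- 1ˢ u (u ^ˢ p) n ⟩
    (1ˢ *ˢ (u ^ˢ p)) n -ℚ (u *ˢ (u ^ˢ p)) n    ≡⟨ cong (_-ℚ (u ^ˢ suc p) n) (*ˢ-identityˡ (u ^ˢ p) n) ⟩
    d                                          ∎
  -- The successor case uses the lemma itself at a smaller exponent and in every degree.
  second : ∀ p → (u *ˢ (θ (u ^ˢ p) ∘ suc)) n ≡ fromℕ p *ℚ ((u ^ˢ p) n -ℚ (u ^ˢ suc p) n)
  second zero = begin
    (u *ˢ (θ 1ˢ ∘ suc)) n
      ≡⟨ *ˢ-cong {f = u} (λ _ → refl) (λ m → trans (ℚₚ.*-zeroʳ (fromℕ (suc m))) (sym (ℚₚ.*-zeroˡ 0ℚ))) n ⟩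
    -- The zero series is written as a multiple by `0ℚ` so that the scalar can leave the product.
    (u *ˢ (λ _ → 0ℚ *ℚ 0ℚ)) n
      ≡⟨ *ˢ-scaleʳ 0ℚ u (λ _ → 0ℚ) n ⟩
    0ℚ *ℚ (u *ˢ (λ _ → 0ℚ)) n
      ≡⟨ trans (ℚₚ.*-zeroˡ ((u *ˢ (λ _ → 0ℚ)) n)) (sym (ℚₚ.*-zeroˡ ((u ^ˢ 0) n -ℚ (u ^ˢ 1) n))) ⟩
    0ℚ *ℚ ((u ^ˢ 0) n -ℚ (u ^ˢ 1) n) ∎
  second (suc p) = begin
    (u *ˢ (θ (u ^ˢ suc p) ∘ suc)) n
      ≡⟨ *ˢ-cong {f = u} (λ _ → refl) (θ-[1-e^-t]^ p) n ⟩
    (u *ˢ (λ m → fromℕ (suc p) *ℚ ((u ^ˢ p) m -ℚ (u ^ˢ suc p) m))) n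
      ≡⟨ *ˢ-scaleʳ (fromℕ (suc p)) u ((u ^ˢ p) -ˢ (u ^ˢ suc p)) n ⟩
    fromℕ (suc p) *ℚ (u *ˢ ((u ^ˢ p) -ˢ (u ^ˢ suc p))) n
      ≡⟨ cong (fromℕ (suc p) *ℚ_) (*ˢ-distribˡ-- u (u ^ˢ p) (u ^ˢ suc p) n) ⟩
    fromℕ (suc p) *ℚ ((u ^ˢ suc p) n -ℚ (u ^ˢ suc (suc p)) n) ∎

-- Stirling numbers and powers of 1 - e⁻ᵗ

-- The triangular recurrence serves as the link: the coefficients of uᵖ obey it up to a factor, and
-- so does the expansion of xⁿ in falling factorials.
stirling₂ : ℕ → ℕ → ℚ
stirling₂ zero    zero    = 1ℚ
stirling₂ zero    (suc l) = 0ℚ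
stirling₂ (suc n) zero    = 0ℚ
stirling₂ (suc n) (suc l) = stirling₂ n l +ℚ fromℕ (suc l) *ℚ stirling₂ n (suc l)

stirling₂-> : ∀ n l → n < l → stirling₂ n l ≡ 0ℚ
stirling₂-> zero    (suc l) _         = refl
stirling₂-> (suc n) (suc l) (s<s n<l) = begin
  stirling₂ n l +ℚ fromℕ (suc l) *ℚ stirling₂ n (suc l)
    ≡⟨ cong₂ (λ a b → a +ℚ fromℕ (suc l) *ℚ b) (stirling₂-> n l n<l)
         (stirling₂-> n (suc l) (ℕₚ.m<n⇒m<1+n n<l)) ⟩
  0ℚ +ℚ fromℕ (suc l) *ℚ 0ℚ
    ≡⟨ solve 1 (λ a → con 0ℚ :+ a :* con 0ℚ := con 0ℚ) refl (fromℕ (suc l)) ⟩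
  0ℚ ∎

-- The classical generating function (eᵗ - 1)ᵖ = p! ∑ S₂(n,p) tⁿ / n!, taken at -t. Induction on n
-- compares the differential recurrence of uᵖ with that of `stirling₂`.
[1-e^-t]^-stirling₂ : ∀ n p → fromℕ (n !) *ℚ (1-e^-t ^ˢ p) n ≡
                      [-1]^ (p ℕ.+ n) *ℚ fromℕ (p !) *ℚ stirling₂ n p
[1-e^-t]^-stirling₂ zero zero = refl
[1-e^-t]^-stirling₂ zero (suc p) = begin
  1ℚ *ℚ (0ℚ *ℚ (1-e^-t ^ˢ p) 0 +ℚ 0ℚ)
    ≡⟨ solve 2 (λ a b → con 1ℚ :* (con 0ℚ :* a :+ con 0ℚ) := b :* con 0ℚ) refl
         ((1-e^-t ^ˢ p) 0) ([-1]^ (suc p ℕ.+ 0) *ℚ fromℕ (suc p !)) ⟩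
  [-1]^ (suc p ℕ.+ 0) *ℚ fromℕ (suc p !) *ℚ 0ℚ ∎
[1-e^-t]^-stirling₂ (suc n) zero =
  solve 2 (λ a b → a :* con 0ℚ := b :* con 0ℚ) refl (fromℕ (suc n !)) ([-1]^ suc n *ℚ fromℕ 1)
[1-e^-t]^-stirling₂ (suc n) (suc p) = begin
  fromℕ (suc n !) *ℚ (u ^ˢ suc p) (suc n)
    ≡⟨ cong (_*ℚ (u ^ˢ suc p) (suc n)) (fromℕ-homo-* (suc n) (n !)) ⟩
  fromℕ (suc n) *ℚ fromℕ (n !) *ℚ (u ^ˢ suc p) (suc n)
    ≡⟨ solve 3 (λ a b c → a :* b :* c := b :* (a :* c)) refl
           (fromℕ (suc n)) (fromℕ (n !)) ((u ^ˢ suc p) (suc n)) ⟩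
  fromℕ (n !) *ℚ θ (u ^ˢ suc p) (suc n)
    ≡⟨ cong (fromℕ (n !) *ℚ_) (θ-[1-e^-t]^ p n) ⟩
  fromℕ (n !) *ℚ (fromℕ (suc p) *ℚ ((u ^ˢ p) n -ℚ (u ^ˢ suc p) n))
    ≡⟨ solve 4 (λ a b c d → a :* (b :* (c :- d)) := b :* (a :* c :- a :* d)) refl
         (fromℕ (n !)) (fromℕ (suc p)) ((u ^ˢ p) n) ((u ^ˢ suc p) n) ⟩
  fromℕ (suc p) *ℚ (fromℕ (n !) *ℚ (u ^ˢ p) n -ℚ fromℕ (n !) *ℚ (u ^ˢ suc p) n)
    ≡⟨ cong (fromℕ (suc p) *ℚ_) (cong₂ _-ℚ_ ([1-e^-t]^-stirling₂ n p) ([1-e^-t]^-stirling₂ n (suc p))) ⟩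
  -- The second term carries one more sign, from the exponent `suc p ℕ.+ n`; this turns the
  -- difference into the sum of the Stirling recurrence.
  fromℕ (suc p) *ℚ (s *ℚ fromℕ (p !) *ℚ S₀ -ℚ -ℚ 1ℚ *ℚ s *ℚ fromℕ (suc p !) *ℚ S₁)
    ≡⟨ cong (λ a → fromℕ (suc p) *ℚ (s *ℚ fromℕ (p !) *ℚ S₀ -ℚ -ℚ 1ℚ *ℚ s *ℚ a *ℚ S₁))
         (fromℕ-homo-* (suc p) (p !)) ⟩
  fromℕ (suc p) *ℚ (s *ℚ fromℕ (p !) *ℚ S₀ -ℚ -ℚ 1ℚ *ℚ s *ℚ (fromℕ (suc p) *ℚ fromℕ (p !)) *ℚ S₁)
    ≡⟨ solve 5 (λ m s f a b → m :* (s :* f :* a :- con (-ℚ 1ℚ) :* s :* (m :* f) :* b)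
                  := con (-ℚ 1ℚ) :* (con (-ℚ 1ℚ) :* s) :* (m :* f) :* (a :+ m :* b)) refl
         (fromℕ (suc p)) s (fromℕ (p !)) S₀ S₁ ⟩
  [-1]^ (suc (suc (p ℕ.+ n))) *ℚ (fromℕ (suc p) *ℚ fromℕ (p !)) *ℚ (S₀ +ℚ fromℕ (suc p) *ℚ S₁)
    ≡⟨ cong₂ (λ m a → [-1]^ (suc m) *ℚ a *ℚ (S₀ +ℚ fromℕ (suc p) *ℚ S₁)) (ℕₚ.+-suc p n)
         (fromℕ-homo-* (suc p) (p !)) ⟨
  [-1]^ (suc p ℕ.+ suc n) *ℚ fromℕ (suc p !) *ℚ stirling₂ (suc n) (suc p) ∎
  where
  u : ℚ⟦t⟧
  u = 1-e^-t
  s S₀ S₁ : ℚ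
  s = [-1]^ (p ℕ.+ n)
  S₀ = stirling₂ n p
  S₁ = stirling₂ n (suc p)

-- Coefficients of polynomials

coeff-+ : ∀ p q i → coeff (p + q) i ≡ coeff p i +ℚ coeff q i
coeff-+ []      q       i       = sym (ℚₚ.+-identityˡ _)
coeff-+ (a ∷ p) []      i       = sym (ℚₚ.+-identityʳ _)
coeff-+ (a ∷ p) (b ∷ q) zero    = refl
coeff-+ (a ∷ p) (b ∷ q) (suc i) = coeff-+ p q i

coeff-• : ∀ a p i → coeff (a • p) i ≡ a *ℚ coeff p i
coeff-• a []      i       = sym (ℚₚ.*-zeroʳ a)
coeff-• a (b ∷ p) zero    = refl
coeff-• a (b ∷ p) (suc i) = coeff-• a p i

coeff-∑ : ∀ n f i → coeff (∑ n f) i ≡ ∑ℚ[ j < n ] coeff (f j) i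
coeff-∑ zero    f i = refl
coeff-∑ (suc n) f i = trans (coeff-+ (f 0) (∑ n (f ∘ suc)) i) (cong (coeff (f 0) i +ℚ_) (coeff-∑ n (f ∘ suc) i))

coeff-∑-• : ∀ n (c : ℕ → ℚ) (f : ℕ → ℚ[x]) i →
  coeff (∑[ j < n ] (c j • f j)) i ≡ ∑ℚ[ j < n ] (c j *ℚ coeff (f j) i)
coeff-∑-• n c f i = trans (coeff-∑ n (λ j → c j • f j) i) (∑-cong′ n (λ j → coeff-• (c j) (f j) i))

coeff-*-linear-zero : ∀ p b c → coeff (p * (b ∷ c ∷ [])) 0 ≡ coeff p 0 *ℚ b
coeff-*-linear-zero []      b c = sym (ℚₚ.*-zeroˡ b)
coeff-*-linear-zero (a ∷ p) b c = ℚₚ.+-identityʳ (a *ℚ b)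

coeff-*-linear-suc : ∀ p b c i → coeff (p * (b ∷ c ∷ [])) (suc i) ≡ coeff p (suc i) *ℚ b +ℚ coeff p i *ℚ c
coeff-*-linear-suc [] b c i = solve 2 (λ b c → con 0ℚ := con 0ℚ :* b :+ con 0ℚ :* c) refl b c
coeff-*-linear-suc (a ∷ p) b c i = begin
  coeff ((a *ℚ c ∷ []) + p * (b ∷ c ∷ [])) i
    ≡⟨ coeff-+ (a *ℚ c ∷ []) (p * (b ∷ c ∷ [])) i ⟩
  coeff (a *ℚ c ∷ []) i +ℚ coeff (p * (b ∷ c ∷ [])) i
    ≡⟨ helper i ⟩
  coeff p i *ℚ b +ℚ coeff (a ∷ p) i *ℚ c ∎
  where
  helper : ∀ i → coeff (a *ℚ c ∷ []) i +ℚ coeff (p * (b ∷ c ∷ [])) i ≡ coeff p i *ℚ b +ℚ coeff (a ∷ p) i *ℚ c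
  helper zero    = trans (cong (a *ℚ c +ℚ_) (coeff-*-linear-zero p b c)) (ℚₚ.+-comm (a *ℚ c) _)
  helper (suc i) = trans (ℚₚ.+-identityˡ _) (coeff-*-linear-suc p b c i)

-- List multiplication leaves a summand `0ℚ • p` and a padding `0ℚ ∷ []`, so the shift holds for
-- coefficients rather than for lists.
coeff-x* : ∀ p i → coeff (x * p) i ≡ coeff (0ℚ ∷ p) i
coeff-x* p i = begin
  coeff (0ℚ • p + (0ℚ ∷ 1ℚ • p + (0ℚ ∷ []))) i
    ≡⟨ coeff-+ (0ℚ • p) (0ℚ ∷ 1ℚ • p + (0ℚ ∷ [])) i ⟩
  coeff (0ℚ • p) i +ℚ coeff (0ℚ ∷ 1ℚ • p + (0ℚ ∷ [])) i
    ≡⟨ cong₂ _+ℚ_ (trans (coeff-• 0ℚ p i) (ℚₚ.*-zeroˡ (coeff p i))) (helper i) ⟩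
  0ℚ +ℚ coeff (0ℚ ∷ p) i
    ≡⟨ ℚₚ.+-identityˡ _ ⟩
  coeff (0ℚ ∷ p) i ∎
  where
  [0]-zero : ∀ i → coeff (0ℚ ∷ []) i ≡ 0ℚ
  [0]-zero zero    = refl
  [0]-zero (suc i) = refl
  helper : ∀ i → coeff (0ℚ ∷ 1ℚ • p + (0ℚ ∷ [])) i ≡ coeff (0ℚ ∷ p) i
  helper zero    = refl
  helper (suc i) = begin
    coeff (1ℚ • p + (0ℚ ∷ [])) i             ≡⟨ coeff-+ (1ℚ • p) (0ℚ ∷ []) i ⟩
    coeff (1ℚ • p) i +ℚ coeff (0ℚ ∷ []) i    ≡⟨ cong₂ _+ℚ_ (coeff-• 1ℚ p i) ([0]-zero i) ⟩
    1ℚ *ℚ coeff p i +ℚ 0ℚ                    ≡⟨ solve 1 (λ a → con 1ℚ :* a :+ con 0ℚ := a) refl (coeff p i) ⟩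
    coeff p i                                ∎

-- Falling factorials as a basis

[x]-suc-zero : ∀ l → coeff ([x] suc l) 0 ≡ coeff ([x] l) 0 *ℚ (-ℚ fromℕ l)
-- The factor `x + const (-ℚ fromℕ l)` reduces to the list with entries `0ℚ +ℚ -ℚ fromℕ l` and `1ℚ`.
[x]-suc-zero l = trans (coeff-*-linear-zero ([x] l) (0ℚ +ℚ -ℚ fromℕ l) 1ℚ)
  (cong (coeff ([x] l) 0 *ℚ_) (ℚₚ.+-identityˡ _))

[x]-suc-suc : ∀ l i → coeff ([x] suc l) (suc i) ≡ coeff ([x] l) (suc i) *ℚ (-ℚ fromℕ l) +ℚ coeff ([x] l) i
[x]-suc-suc l i = trans (coeff-*-linear-suc ([x] l) (0ℚ +ℚ -ℚ fromℕ l) 1ℚ i)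
  (cong₂ _+ℚ_ (cong (coeff ([x] l) (suc i) *ℚ_) (ℚₚ.+-identityˡ _)) (ℚₚ.*-identityʳ _))

-- From (x)ₗ₊₁ = (x)ₗ (x - l). The two summands give rise to the two terms of the Stirling
-- recurrence.
x*[x] : ∀ l i → coeff (0ℚ ∷ [x] l) i ≡ coeff ([x] suc l) i +ℚ fromℕ l *ℚ coeff ([x] l) i
x*[x] l zero = begin
  0ℚ
    ≡⟨ solve 2 (λ a m → con 0ℚ := a :* (:- m) :+ m :* a) refl (coeff ([x] l) 0) (fromℕ l) ⟩
  coeff ([x] l) 0 *ℚ (-ℚ fromℕ l) +ℚ fromℕ l *ℚ coeff ([x] l) 0
    ≡⟨ cong (_+ℚ fromℕ l *ℚ coeff ([x] l) 0) ([x]-suc-zero l) ⟨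
  coeff ([x] suc l) 0 +ℚ fromℕ l *ℚ coeff ([x] l) 0 ∎
x*[x] l (suc i) = begin
  coeff ([x] l) i
    ≡⟨ solve 3 (λ a b m → b := a :* (:- m) :+ b :+ m :* a) refl
           (coeff ([x] l) (suc i)) (coeff ([x] l) i) (fromℕ l) ⟩
  coeff ([x] l) (suc i) *ℚ (-ℚ fromℕ l) +ℚ coeff ([x] l) i +ℚ fromℕ l *ℚ coeff ([x] l) (suc i)
    ≡⟨ cong (_+ℚ fromℕ l *ℚ coeff ([x] l) (suc i)) ([x]-suc-suc l i) ⟨
  coeff ([x] suc l) (suc i) +ℚ fromℕ l *ℚ coeff ([x] l) (suc i) ∎

[x]-degree : ∀ l i → l < i → coeff ([x] l) i ≡ 0ℚ
[x]-degree zero    (suc i) _         = refl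
[x]-degree (suc l) (suc i) (s<s l<i) = begin
  coeff ([x] suc l) (suc i)
    ≡⟨ [x]-suc-suc l i ⟩
  coeff ([x] l) (suc i) *ℚ (-ℚ fromℕ l) +ℚ coeff ([x] l) i
    ≡⟨ cong₂ (λ a b → a *ℚ (-ℚ fromℕ l) +ℚ b) ([x]-degree l (suc i) (ℕₚ.m<n⇒m<1+n l<i)) ([x]-degree l i l<i) ⟩
  0ℚ *ℚ (-ℚ fromℕ l) +ℚ 0ℚ
    ≡⟨ solve 1 (λ a → con 0ℚ :* a :+ con 0ℚ := con 0ℚ) refl (-ℚ fromℕ l) ⟩
  0ℚ ∎

[x]-monic : ∀ l → coeff ([x] l) l ≡ 1ℚ
[x]-monic zero    = refl
[x]-monic (suc l) = begin
  coeff ([x] suc l) (suc l)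
    ≡⟨ [x]-suc-suc l l ⟩
  coeff ([x] l) (suc l) *ℚ (-ℚ fromℕ l) +ℚ coeff ([x] l) l
    ≡⟨ cong₂ (λ a b → a *ℚ (-ℚ fromℕ l) +ℚ b) ([x]-degree l (suc l) (ℕₚ.n<1+n l)) ([x]-monic l) ⟩
  0ℚ *ℚ (-ℚ fromℕ l) +ℚ 1ℚ
    ≡⟨ solve 1 (λ a → con 0ℚ :* a :+ con 1ℚ := con 1ℚ) refl (-ℚ fromℕ l) ⟩
  1ℚ ∎

[x]-combination : (ℕ → ℚ) → ℕ → ℕ → ℚ
[x]-combination c n i = ∑ℚ[ l < n ] (c l *ℚ coeff ([x] l) i)

-- Among (x)₀, ..., (x)ₙ only the last reaches degree n, and it is monic.
[x]-leading : ∀ c n → [x]-combination c (suc n) n ≡ c n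
[x]-leading c n = begin
  [x]-combination c (suc n) n
    ≡⟨ ∑-init-last n (λ l → c l *ℚ coeff ([x] l) n) ⟩
  ∑ℚ[ l < n ] (c l *ℚ coeff ([x] l) n) +ℚ c n *ℚ coeff ([x] n) n
    ≡⟨ cong₂ (λ a b → a +ℚ c n *ℚ b)
         (trans (∑-cong n (λ l l<n → trans (cong (c l *ℚ_) ([x]-degree l n l<n)) (ℚₚ.*-zeroʳ (c l)))) (∑-zero n))
         ([x]-monic n) ⟩
  0ℚ +ℚ c n *ℚ 1ℚ
    ≡⟨ solve 1 (λ a → con 0ℚ :+ a :* con 1ℚ := a) refl (c n) ⟩
  c n ∎

-- Descent from the top degree: the leading coefficient gives equality of the last scalars, whose
-- common term is then cancelled.
[x]-independent : ∀ n c d → (∀ i → [x]-combination c n i ≡ [x]-combination d n i) →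
                  ∀ l → l < n → c l ≡ d l
[x]-independent (suc n) c d eq l l<1+n with ℕₚ.m<1+n⇒m<n∨m≡n l<1+n
... | inj₂ refl = trans (sym ([x]-leading c n)) (trans (eq n) ([x]-leading d n))
... | inj₁ l<n  = [x]-independent n c d eq′ l l<n
  where
  cₙ≡dₙ : c n ≡ d n
  cₙ≡dₙ = trans (sym ([x]-leading c n)) (trans (eq n) ([x]-leading d n))
  eq′ : ∀ i → [x]-combination c n i ≡ [x]-combination d n i
  eq′ i = ∙-cancelʳ (c n *ℚ coeff ([x] n) i) _ _ (begin
    [x]-combination c n i +ℚ c n *ℚ coeff ([x] n) i  ≡⟨ ∑-init-last n (λ l → c l *ℚ coeff ([x] l) i) ⟨
    [x]-combination c (suc n) i                      ≡⟨ eq i ⟩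
    [x]-combination d (suc n) i                      ≡⟨ ∑-init-last n (λ l → d l *ℚ coeff ([x] l) i) ⟩
    [x]-combination d n i +ℚ d n *ℚ coeff ([x] n) i
      ≡⟨ cong (λ a → [x]-combination d n i +ℚ a *ℚ coeff ([x] n) i) cₙ≡dₙ ⟨
    [x]-combination d n i +ℚ c n *ℚ coeff ([x] n) i  ∎)
    where open GroupProperties ℚₚ.+-0-group using (∙-cancelʳ)

-- Multiplying the expansion of xⁿ by x replaces each x (x)ₗ by (x)ₗ₊₁ + l (x)ₗ. Reindexing the
-- second part collects the coefficient of (x)ₗ₊₁ into the recurrence.
x^n-stirling₂ : ∀ n i → coeff (x ^ n) i ≡ [x]-combination (stirling₂ n) (suc n) i
x^n-stirling₂ zero i = solve 1 (λ a → a := con 1ℚ :* a :+ con 0ℚ) refl (coeff (const 1ℚ) i)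
x^n-stirling₂ (suc n) i = begin
  coeff (x * x ^ n) i
    ≡⟨ coeff-x* (x ^ n) i ⟩
  coeff (0ℚ ∷ x ^ n) i
    ≡⟨ shift i ⟩
  ∑ℚ[ l < suc n ] (S l *ℚ coeff (0ℚ ∷ [x] l) i)
    ≡⟨ ∑-cong′ (suc n) (λ l → trans (cong (S l *ℚ_) (x*[x] l i))
         (solve 4 (λ s a m b → s :* (a :+ m :* b) := s :* a :+ m :* s :* b) refl
            (S l) (coeff ([x] suc l) i) (fromℕ l) (coeff ([x] l) i))) ⟩
  ∑ℚ[ l < suc n ] (S l *ℚ coeff ([x] suc l) i +ℚ g l)
    ≡⟨ ∑-distrib-+ (suc n) (λ l → S l *ℚ coeff ([x] suc l) i) g ⟩
  ∑ℚ[ l < suc n ] (S l *ℚ coeff ([x] suc l) i) +ℚ ∑ℚ (suc n) g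
    ≡⟨ cong (∑ℚ[ l < suc n ] (S l *ℚ coeff ([x] suc l) i) +ℚ_) ∑g ⟩
  ∑ℚ[ l < suc n ] (S l *ℚ coeff ([x] suc l) i) +ℚ ∑ℚ (suc n) (g ∘ suc)
    ≡⟨ ∑-distrib-+ (suc n) (λ l → S l *ℚ coeff ([x] suc l) i) (g ∘ suc) ⟨
  ∑ℚ[ l < suc n ] (S l *ℚ coeff ([x] suc l) i +ℚ g (suc l))
    ≡⟨ ∑-cong′ (suc n) (λ l → sym (ℚₚ.*-distribʳ-+ (coeff ([x] suc l) i) (S l) (fromℕ (suc l) *ℚ S (suc l)))) ⟩
  ∑ℚ[ l < suc n ] (stirling₂ (suc n) (suc l) *ℚ coeff ([x] suc l) i)
    -- The term l = 0 is added; its coefficient `stirling₂ (suc n) 0` is zero.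
    ≡⟨ solve 2 (λ a b → a := con 0ℚ :* b :+ a) refl _ (coeff ([x] 0) i) ⟩
  [x]-combination (stirling₂ (suc n)) (suc (suc n)) i ∎
  where
  S g : ℕ → ℚ
  S = stirling₂ n
  g l = fromℕ l *ℚ S l *ℚ coeff ([x] l) i
  shift : ∀ i → coeff (0ℚ ∷ x ^ n) i ≡ ∑ℚ[ l < suc n ] (S l *ℚ coeff (0ℚ ∷ [x] l) i)
  shift zero    = sym (trans (∑-cong′ (suc n) (λ l → ℚₚ.*-zeroʳ (S l))) (∑-zero (suc n)))
  shift (suc i) = x^n-stirling₂ n i
  -- The sum can be shifted by one because the terms at both ends vanish: at 0 by the factor l, at n
  -- + 1 because `stirling₂ n (suc n)` is zero.
  ∑g : ∑ℚ (suc n) g ≡ ∑ℚ (suc n) (g ∘ suc)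
  ∑g = begin
    0ℚ *ℚ S 0 *ℚ coeff ([x] 0) i +ℚ ∑ℚ n (g ∘ suc)
      ≡⟨ solve 4 (λ s a m b → con 0ℚ :* s :* a :+ b := b :+ m :* con 0ℚ) refl
           (S 0) (coeff ([x] 0) i) (fromℕ (suc n) *ℚ coeff ([x] suc n) i) (∑ℚ n (g ∘ suc)) ⟩
    ∑ℚ n (g ∘ suc) +ℚ fromℕ (suc n) *ℚ coeff ([x] suc n) i *ℚ 0ℚ
      ≡⟨ cong (λ a → ∑ℚ n (g ∘ suc) +ℚ fromℕ (suc n) *ℚ coeff ([x] suc n) i *ℚ a)
           (stirling₂-> n (suc n) (ℕₚ.n<1+n n)) ⟨
    ∑ℚ n (g ∘ suc) +ℚ fromℕ (suc n) *ℚ coeff ([x] suc n) i *ℚ S (suc n)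
      ≡⟨ cong (∑ℚ n (g ∘ suc) +ℚ_) (solve 3 (λ a b c → a :* b :* c := a :* c :* b) refl
             (fromℕ (suc n)) (coeff ([x] suc n) i) (S (suc n))) ⟩
    ∑ℚ n (g ∘ suc) +ℚ g (suc n)
      ≡⟨ ∑-init-last n (g ∘ suc) ⟨
    ∑ℚ (suc n) (g ∘ suc) ∎

IsStirling₂-unique : ∀ S → IsStirling₂ S → ∀ n l → l < suc n → S n l ≡ stirling₂ n l
IsStirling₂-unique S isS n = [x]-independent (suc n) (S n) (stirling₂ n) (λ i → begin
  [x]-combination (S n) (suc n) i            ≡⟨ coeff-∑-• (suc n) (S n) [x]_ i ⟨
  coeff (∑[ l < suc n ] (S n l • [x] l)) i   ≡⟨ isS n i ⟨
  coeff (x ^ n) i                            ≡⟨ x^n-stirling₂ n i ⟩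
  [x]-combination (stirling₂ n) (suc n) i    ∎)

-- Binomial convolution and comparison of coefficients

-- The factorial formula is a quotient of naturals, exact because k! (n - k)! divides n!. It
-- converts Cauchy products into binomial convolutions.
nCk*k!*[n∸k]! : ∀ n k → k ℕ.≤ n → fromℕ (n C k) *ℚ fromℕ (k !) *ℚ fromℕ ((n ∸ k) !) ≡ fromℕ (n !)
nCk*k!*[n∸k]! n k k≤n = begin
  fromℕ (n C k) *ℚ fromℕ (k !) *ℚ fromℕ ((n ∸ k) !)    ≡⟨ ℚₚ.*-assoc (fromℕ (n C k)) _ _ ⟩
  fromℕ (n C k) *ℚ (fromℕ (k !) *ℚ fromℕ ((n ∸ k) !))
    ≡⟨ cong (fromℕ (n C k) *ℚ_) (fromℕ-homo-* (k !) ((n ∸ k) !)) ⟨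
  fromℕ (n C k) *ℚ fromℕ (k ! ℕ.* (n ∸ k) !)           ≡⟨ fromℕ-homo-* (n C k) (k ! ℕ.* (n ∸ k) !) ⟨
  fromℕ ((n C k) ℕ.* (k ! ℕ.* (n ∸ k) !))
    ≡⟨ cong (λ c → fromℕ (c ℕ.* (k ! ℕ.* (n ∸ k) !))) (nCk≡n!/k![n-k]! k≤n) ⟩
  fromℕ (n ! ℕ./ (k ! ℕ.* (n ∸ k) !) ℕ.* (k ! ℕ.* (n ∸ k) !))
    ≡⟨ cong fromℕ (m/n*n≡m (subst (ℕDiv._∣ n !) (ℕₚ.*-comm ((n ∸ k) !) (k !)) ([n∸k]!k!∣n! k≤n))) ⟩
  fromℕ (n !) ∎
  where
  instance _ = k ℕₚ.!* (n ∸ k) !≢0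

-- Fixing a power of x turns series over ℚ[x] into series over ℚ, where the algebra of `*ˢ` is
-- available.
coeff-•ˢ : ∀ f g n i → coeff ((f •ˢ g) n) i ≡ (f *ˢ (λ m → coeff (g m) i)) n
coeff-•ˢ f g n i = coeff-∑-• (suc n) f (λ j → g (n ∸ j)) i

-- Expand Li_k(u) in powers of u and insert their Stirling form; the factor 1 / (l + 1) reduces (l +
-- 1)! to l!.
coeff-Li∘[1-e^-t] : ∀ S → IsStirling₂ S → ∀ k l →
  ∑ℚ[ i < suc l ]
    (let p = suc i in
     [-1]^ (p ℕ.+ l ℕ.+ 1) *ℚ (1/ p ^ k) *ℚ fromℕ (p !)
       *ℚ (S (suc l) p *ℚ (+ 1 / suc l)))
  ≡ fromℕ (l !) *ℚ (Li k ∘ˢ 1-e^-t) (suc l)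
coeff-Li∘[1-e^-t] S isS k l = begin
  _
    ≡⟨ ∑-cong (suc l) term ⟩
  ∑ℚ[ i < suc l ] (fromℕ (l !) *ℚ (Li k (suc i) *ℚ (1-e^-t ^ˢ suc i) (suc l)))
    ≡⟨ *-distribˡ-∑ (suc l) (fromℕ (l !)) (λ i → Li k (suc i) *ℚ (1-e^-t ^ˢ suc i) (suc l)) ⟨
  fromℕ (l !) *ℚ ∑ℚ[ i < suc l ] (Li k (suc i) *ℚ (1-e^-t ^ˢ suc i) (suc l))
    -- The term of index 0 in the substitution computes to `0ℚ`, so the sum starts at p = 1.
    ≡⟨ cong (fromℕ (l !) *ℚ_) (ℚₚ.+-identityˡ _) ⟨
  fromℕ (l !) *ℚ (Li k ∘ˢ 1-e^-t) (suc l) ∎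
  where
  term : ∀ i → i < suc l → _ ≡ _
  term i i<1+l = begin
    [-1]^ (p ℕ.+ l ℕ.+ 1) *ℚ L *ℚ fromℕ (p !) *ℚ (S (suc l) p *ℚ r)
      ≡⟨ cong₂ (λ m a → [-1]^ m *ℚ L *ℚ fromℕ (p !) *ℚ (a *ℚ r))
           (trans (ℕₚ.+-assoc p l 1) (cong (p ℕ.+_) (ℕₚ.+-comm l 1)))
           -- Here p ≤ l + 1, which is the range where the defining identity determines
           -- `S (suc l) p`.
           (IsStirling₂-unique S isS (suc l) p (s<s i<1+l)) ⟩
    [-1]^ (p ℕ.+ suc l) *ℚ L *ℚ fromℕ (p !) *ℚ (stirling₂ (suc l) p *ℚ r)
      ≡⟨ solve 5 (λ s L f a r → s :* L :* f :* (a :* r) := L :* r :* (s :* f :* a)) refl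
           ([-1]^ (p ℕ.+ suc l)) L (fromℕ (p !)) (stirling₂ (suc l) p) r ⟩
    L *ℚ r *ℚ ([-1]^ (p ℕ.+ suc l) *ℚ fromℕ (p !) *ℚ stirling₂ (suc l) p)
      ≡⟨ cong (L *ℚ r *ℚ_) ([1-e^-t]^-stirling₂ (suc l) p) ⟨
    L *ℚ r *ℚ (fromℕ (suc l !) *ℚ e)
      ≡⟨ cong (λ a → L *ℚ r *ℚ (a *ℚ e)) (fromℕ-homo-* (suc l) (l !)) ⟩
    L *ℚ r *ℚ (fromℕ (suc l) *ℚ fromℕ (l !) *ℚ e)
      ≡⟨ solve 5 (λ L r m f e → L :* r :* (m :* f :* e) := m :* r :* (f :* (L :* e))) refl L r (fromℕ (suc l)) (fromℕ (l !)) e ⟩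
    fromℕ (suc l) *ℚ r *ℚ (fromℕ (l !) *ℚ (L *ℚ e))
      ≡⟨ cong (_*ℚ (fromℕ (l !) *ℚ (L *ℚ e))) (fromℕ-inverseʳ (suc l)) ⟩
    1ℚ *ℚ (fromℕ (l !) *ℚ (L *ℚ e))
      ≡⟨ ℚₚ.*-identityˡ _ ⟩
    fromℕ (l !) *ℚ (L *ℚ e) ∎
    where
    p : ℕ
    p = suc i
    L r e : ℚ
    L = 1/ p ^ k
    r = + 1 / suc l
    e = (1-e^-t ^ˢ p) (suc l)

theorem2 : (S₂ : ℕ → ℕ → ℚ) → IsStirling₂ S₂ → (k : ℤ) (n : ℕ) →
    polyBernoulli₂ k n ≈
    ∑[ l < suc n ]
    ((fromℕ (n C l) *ℚ
    (∑ℚ[ i < suc l ]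
    (let p = suc i in
    [-1]^ (p ℕ.+ l ℕ.+ 1) *ℚ (1/ p ^ k) *ℚ fromℕ (p !)
    *ℚ (S₂ (suc l) p *ℚ (+ 1 / suc l)))))
    • bernoulli₂ (n ∸ l))
theorem2 S₂ isS₂ k n i = begin
  coeff (polyBernoulli₂ k n) i
    ≡⟨ coeff-• (fromℕ (n !)) (((F /ˢ log[1+t]) •ˢ [1+t]^x) n) i ⟩
  fromℕ (n !) *ℚ coeff (((F /ˢ log[1+t]) •ˢ [1+t]^x) n) i
    ≡⟨ cong (fromℕ (n !) *ℚ_) (coeff-•ˢ (F /ˢ log[1+t]) [1+t]^x n i) ⟩
  fromℕ (n !) *ℚ ((F /ˢ log[1+t]) *ˢ B) n
    -- `F ∘ suc` is F / t. After reassociation `Q *ˢ B` is the xⁱ-coefficient of the generating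
    -- function of `bernoulli₂`.
    ≡⟨ cong (fromℕ (n !) *ℚ_) (*ˢ-cong {g = B} (/ˢ-shift F log[1+t]) (λ _ → refl) n) ⟩
  fromℕ (n !) *ℚ (((F ∘ suc) *ˢ Q) *ˢ B) n
    ≡⟨ cong (fromℕ (n !) *ℚ_) (*ˢ-assoc (F ∘ suc) Q B n) ⟩
  fromℕ (n !) *ℚ ((F ∘ suc) *ˢ (Q *ˢ B)) n
    ≡⟨ *-distribˡ-∑ (suc n) (fromℕ (n !)) (λ l → F (suc l) *ℚ (Q *ˢ B) (n ∸ l)) ⟩
  ∑ℚ[ l < suc n ] (fromℕ (n !) *ℚ (F (suc l) *ℚ (Q *ˢ B) (n ∸ l)))
    ≡⟨ ∑-cong (suc n) term ⟨
  ∑ℚ[ l < suc n ] (fromℕ (n C l) *ℚ a l *ℚ coeff (bernoulli₂ (n ∸ l)) i)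
    ≡⟨ coeff-∑-• (suc n) (λ l → fromℕ (n C l) *ℚ a l) (λ l → bernoulli₂ (n ∸ l)) i ⟨
  coeff (∑[ l < suc n ] ((fromℕ (n C l) *ℚ a l) • bernoulli₂ (n ∸ l))) i ∎
  where
  F Q B : ℚ⟦t⟧
  F = Li k ∘ˢ 1-e^-t
  Q = t /ˢ log[1+t]
  B m = coeff ([1+t]^x m) i
  a : ℕ → ℚ
  a l = ∑ℚ[ i < suc l ]
    (let p = suc i in
     [-1]^ (p ℕ.+ l ℕ.+ 1) *ℚ (1/ p ^ k) *ℚ fromℕ (p !)
       *ℚ (S₂ (suc l) p *ℚ (+ 1 / suc l)))
  -- Of n! = C(n,l) l! (n - l)!, the factor l! goes to F / t and (n - l)! to the Bernoulli series.
  term : ∀ l → l < suc n →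
    fromℕ (n C l) *ℚ a l *ℚ coeff (bernoulli₂ (n ∸ l)) i ≡
    fromℕ (n !) *ℚ (F (suc l) *ℚ (Q *ˢ B) (n ∸ l))
  term l l<1+n = begin
    fromℕ (n C l) *ℚ a l *ℚ coeff (bernoulli₂ (n ∸ l)) i
      ≡⟨ cong₂ (λ u v → fromℕ (n C l) *ℚ u *ℚ v) (coeff-Li∘[1-e^-t] S₂ isS₂ k l)
           (trans (coeff-• (fromℕ ((n ∸ l) !)) ((Q •ˢ [1+t]^x) (n ∸ l)) i)
             (cong (fromℕ ((n ∸ l) !) *ℚ_) (coeff-•ˢ Q [1+t]^x (n ∸ l) i))) ⟩
    fromℕ (n C l) *ℚ (fromℕ (l !) *ℚ F (suc l)) *ℚ (fromℕ ((n ∸ l) !) *ℚ (Q *ˢ B) (n ∸ l))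
      ≡⟨ solve 5 (λ c l f m b → c :* (l :* f) :* (m :* b) := c :* l :* m :* (f :* b)) refl
           (fromℕ (n C l)) (fromℕ (l !)) (F (suc l)) (fromℕ ((n ∸ l) !)) ((Q *ˢ B) (n ∸ l)) ⟩
    fromℕ (n C l) *ℚ fromℕ (l !) *ℚ fromℕ ((n ∸ l) !) *ℚ (F (suc l) *ℚ (Q *ˢ B) (n ∸ l))
      ≡⟨ cong (_*ℚ (F (suc l) *ℚ (Q *ˢ B) (n ∸ l))) (nCk*k!*[n∸k]! n l (s≤s⁻¹ l<1+n)) ⟩
    fromℕ (n !) *ℚ (F (suc l) *ℚ (Q *ˢ B) (n ∸ l)) ∎
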